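{- For every integer $r\geq 2$ there exists $n_0$ such that if $G$ is a graph on $n\geq n_0$ vertices with minimum degree $\delta(G)> \left(1-\frac{1}{e\,r!}\right)n$, then $\mathrm{tp}_r(G)\leq r$.
   Context: Graphs are finite and simple; $e$ is the base of the natural logarithm. An $r$-coloring of a graph $G$ is an arbitrary assignment of one of $r$ colors to each edge of $G$. The $r$-color tree-partition number $\mathrm{tp}_r(G)$ is the minimum $s$ such that for every $r$-coloring of the edges of $G$ there exists a collection of monochromatic connected subgraphs $\{H_1,\dots,H_t\}$ of $G$ with $t\leq s$ such that $\{V(H_1),\dots,V(H_t)\}$ is a partition of $V(G)$. (A single vertex counts as a monochromatic connected subgraph.) -}

module Defs where

open import Data.Nat as ℕ using (ℕ; zero; suc; _≤_; z≤n; s≤s; _!)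
import Data.Nat.Properties as ℕ
open import Data.Integer using (+_)
open import Data.Rational as ℚ using (ℚ; 0ℚ; 1ℚ; Positive)
import Data.Rational.Properties as ℚ
open import Data.Fin using (Fin; zero; suc; _≟_)
open import Data.Fin.Properties using (all?; any?)
open import Data.Fin.Subset using (Subset; _∈_; _∉_; ∣_∣; Nonempty; ⁅_⁆; ⊥)
open import Data.Fin.Subset.Properties
  using (_∈?_; anySubset?; nonempty?; x∈⁅x⁆; x∈⁅y⁆⇒x≡y; ∉⊥)
open import Data.Vec.Base using (tabulate)
open import Data.Vec.Properties using (lookup∘tabulate; lookup⇒[]=; []=⇒lookup)
import Data.Vec.Functional as F
open import Data.List.Base as List using (List; []; _∷_; allFin)
open import Data.List.Extrema.Nat using (min)
import Data.List.Membership.Propositional as L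
open import Data.List.Membership.Propositional.Properties using (∈-allFin)
open import Data.List.Relation.Unary.Any using (here; there)
open import Data.Product using (Σ; ∃; ∃-syntax; ∃!; _×_; _,_; proj₁; proj₂)
open import Data.Sum using (_⊎_; inj₁; inj₂)
open import Data.Empty using (⊥-elim)
open import Function using (_∘_)
open import Level using (0ℓ)
open import Relation.Nullary using (¬_; Dec; yes; no; does)
open import Relation.Nullary.Decidable
  using (map′; _×-dec_; _⊎-dec_; _→-dec_; ¬?; decidable-stable; dec-true)
open import Relation.Unary using (Pred; Decidable)
open import Relation.Binary using (Rel)
import Relation.Binary as B
open import Relation.Binary.Construct.Closure.ReflexiveTransitive
  using (Star; ε; _◅_; _◅◅_)
import Relation.Binary.Construct.Closure.ReflexiveTransitive as Star
open import Relation.Binary.PropositionalEquality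
  using (_≡_; _≗_; refl; sym; trans; subst)

------------------------------------------------------------------------
-- Graphs

record Graph (n : ℕ) : Set where
  field
    N        : Fin n → Subset n
    N-sym    : ∀ {u v} → v ∈ N u → u ∈ N v
    N-irrefl : ∀ {v} → v ∉ N v

  degree : Fin n → ℕ
  degree v = ∣ N v ∣

  -- The default value n never matters when there is a vertex, since
  -- every degree is less than n.
  minDegree : ℕ
  minDegree = min n (List.tabulate degree)

open Graph public using (N; N-sym; N-irrefl; degree; minDegree)

-- Colours of pairs that are not edges of G are junk: only the colours of
-- edges constrain the subgraphs below. For r ≥ 1 every symmetric colouring
-- of the edges extends to all pairs.
record EdgeColoring (r : ℕ) {n : ℕ} (G : Graph n) : Set where
  field
    color     : Fin n → Fin n → Fin r
    color-sym : ∀ u v → color u v ≡ color v u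

open EdgeColoring public

record IsSubgraph {n : ℕ} (G : Graph n) (V : Subset n) (E : Fin n → Subset n) : Set where
  field
    E-sym : ∀ u v → v ∈ E u → u ∈ E v
    E⊆N   : ∀ u v → v ∈ E u → v ∈ N G u
    E⊆V   : ∀ u v → v ∈ E u → u ∈ V

-- A subgraph need not be induced: V is its vertex set and E u is the set
-- of neighbours of u in it.
record Subgraph {n : ℕ} (G : Graph n) : Set where
  constructor mkSubgraph
  field
    V          : Subset n
    E          : Fin n → Subset n
    isSubgraph : IsSubgraph G V E

open IsSubgraph public
open Subgraph public

module _ {n : ℕ} {G : Graph n} where

  Monochromatic : ∀ {r} → EdgeColoring r G → Subgraph G → Set
  Monochromatic c H = ∃[ i ] ∀ u v → v ∈ E H u → color c u v ≡ i

  Walk : Subgraph G → Rel (Fin n) 0ℓ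
  Walk H = Star (λ u v → v ∈ E H u)

  Connected : Subgraph G → Set
  Connected H = Nonempty (V H) × (∀ u v → u ∈ V H → v ∈ V H → Walk H u v)

  -- The parts are nonempty because connected subgraphs are.
  record TreePartition {r : ℕ} (c : EdgeColoring r G) (t : ℕ) : Set where
    field
      H             : Fin t → Subgraph G
      monochromatic : ∀ i → Monochromatic c (H i)
      connected     : ∀ i → Connected (H i)
      partition     : ∀ v → ∃! _≡_ (λ i → v ∈ V (H i))

TreePartitionable : (r : ℕ) {n : ℕ} (G : Graph n) → ℕ → Set
TreePartitionable r G s =
  (c : EdgeColoring r G) → ∃[ t ] t ≤ s × TreePartition c t

IsMinimum : (ℕ → Set) → ℕ → Set
IsMinimum P s = P s × (∀ s′ → P s′ → s ≤ s′)

------------------------------------------------------------------------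
-- The minimum in the definition of tp exists. This needs, constructively,
-- that TreePartitionable r G is decidable.

module Existence where
  least : ∀ {P : ℕ → Set} → Decidable P → ∀ n → P n → ∃ (IsMinimum P)
  least P? n p with P? 0
  ... | yes p₀ = 0 , p₀ , λ _ _ → z≤n
  least P? zero    p | no ¬p₀ = ⊥-elim (¬p₀ p)
  least P? (suc n) p | no ¬p₀ with least (P? ∘ suc) n p
  ... | s , ps , s-min = suc s , ps , λ where
    zero    p₀ → ⊥-elim (¬p₀ p₀)
    (suc k) pk → s≤s (s-min k pk)

  Searchable : (A : Set) → Rel A 0ℓ → Set₁
  Searchable A _≈_ = {P : Pred A 0ℓ} → (∀ {x y} → x ≈ y → P x → P y) →
                     Decidable P → Dec (∃ P)

  search-Π : ∀ {A : Set} {_≈_ : Rel A 0ℓ} → B.Reflexive _≈_ → Searchable A _≈_ →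
             ∀ m → Searchable (Fin m → A) (λ f g → ∀ i → f i ≈ g i)
  search-Π ≈-refl s zero resp P? =
    map′ (F.[] ,_) (λ (f , p) → resp (λ ()) p) (P? F.[])
  search-Π ≈-refl s (suc m) resp P? =
    map′ (λ (a , g , p) → (a F.∷ g) , p)
         (λ (f , p) → f zero , f ∘ suc ,
            resp (λ { zero → ≈-refl ; (suc i) → ≈-refl }) p)
         (s (λ a≈b (g , p) → g , resp (λ { zero → a≈b ; (suc i) → ≈-refl }) p)
            (λ a → search-Π ≈-refl s m
              (λ f≈g → resp (λ { zero → ≈-refl ; (suc i) → f≈g i }))
              (λ g → P? (a F.∷ g))))

  search-Fin : ∀ r → Searchable (Fin r) _≡_
  search-Fin r _ = any?

  search-Subset : ∀ n → Searchable (Subset n) _≡_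
  search-Subset n _ = anySubset?

  -- Warshall's algorithm: Via ws u v holds when some walk from u to v has
  -- all its interior vertices in ws.
  module _ {n : ℕ} {R : Rel (Fin n) 0ℓ} (R? : B.Decidable R) where

    Via : List (Fin n) → Rel (Fin n) 0ℓ
    Via []       u v = u ≡ v ⊎ R u v
    Via (w ∷ ws) u v = Via ws u v ⊎ (Via ws u w × Via ws w v)

    via? : ∀ ws → B.Decidable (Via ws)
    via? []       u v = (u ≟ v) ⊎-dec R? u v
    via? (w ∷ ws) u v = via? ws u v ⊎-dec (via? ws u w ×-dec via? ws w v)

    via⇒star : ∀ ws {u v} → Via ws u v → Star R u v
    via⇒star []       (inj₁ refl)    = ε
    via⇒star []       (inj₂ e)       = e ◅ ε
    via⇒star (w ∷ ws) (inj₁ p)       = via⇒star ws p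
    via⇒star (w ∷ ws) (inj₂ (p , q)) = via⇒star ws p ◅◅ via⇒star ws q

    weaken : ∀ ws {u v} → Via [] u v → Via ws u v
    weaken []       p = p
    weaken (w ∷ ws) p = inj₁ (weaken ws p)

    join : ∀ ws {u w v} → w L.∈ ws → Via ws u w → Via ws w v → Via ws u v
    join (_ ∷ ws) (here refl) (inj₁ p)       (inj₁ q)       = inj₂ (p , q)
    join (_ ∷ ws) (here refl) (inj₁ p)       (inj₂ (_ , q)) = inj₂ (p , q)
    join (_ ∷ ws) (here refl) (inj₂ (p , _)) (inj₁ q)       = inj₂ (p , q)
    join (_ ∷ ws) (here refl) (inj₂ (p , _)) (inj₂ (_ , q)) = inj₂ (p , q)
    join (_ ∷ ws) (there w∈)  (inj₁ p)       (inj₁ q)       = inj₁ (join ws w∈ p q)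
    join (_ ∷ ws) (there w∈)  (inj₁ p)       (inj₂ (q , s)) = inj₂ (join ws w∈ p q , s)
    join (_ ∷ ws) (there w∈)  (inj₂ (p , s)) (inj₁ q)       = inj₂ (p , join ws w∈ s q)
    join (_ ∷ ws) (there w∈)  (inj₂ (p , _)) (inj₂ (_ , s)) = inj₂ (p , s)

    star⇒via : ∀ {u v} → Star R u v → Via (allFin n) u v
    star⇒via ε       = weaken (allFin n) (inj₁ refl)
    star⇒via (e ◅ p) =
      join (allFin n) (∈-allFin _) (weaken (allFin n) (inj₂ e)) (star⇒via p)

    star? : B.Decidable (Star R)
    star? u v = map′ (via⇒star (allFin n)) star⇒via (via? (allFin n) u v)

  module _ {n : ℕ} {G : Graph n} {r : ℕ} where

    monochromatic? : (c : EdgeColoring r G) → Decidable (Monochromatic c)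
    monochromatic? c H = any? λ i → all? λ u → all? λ v →
      (v ∈? E H u) →-dec (color c u v ≟ i)

    connected? : Decidable (Connected {G = G})
    connected? H = nonempty? (V H) ×-dec (all? λ u → all? λ v →
      (u ∈? V H) →-dec ((v ∈? V H) →-dec star? (λ x y → y ∈? E H x) u v))

    isSubgraph? : ∀ S E′ → Dec (IsSubgraph G S E′)
    isSubgraph? S E′ = map′
      (λ (p , q , s) → record { E-sym = p ; E⊆N = q ; E⊆V = s })
      (λ p → E-sym p , E⊆N p , E⊆V p)
      ((all? λ u → all? λ v → (v ∈? E′ u) →-dec (u ∈? E′ v)) ×-dec
       (all? λ u → all? λ v → (v ∈? E′ u) →-dec (v ∈? N G u)) ×-dec
       (all? λ u → all? λ v → (v ∈? E′ u) →-dec (u ∈? S)))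

    -- The set S spans a monochromatic connected subgraph with edges E′.
    Spans : EdgeColoring r G → Subset n → (Fin n → Subset n) → Set
    Spans c S E′ = Σ (IsSubgraph G S E′) λ p →
      Monochromatic c (mkSubgraph S E′ p) × Connected (mkSubgraph S E′ p)

    spans? : ∀ c S → Decidable (Spans c S)
    spans? c S E′ with isSubgraph? S E′
    ... | no ¬p = no (¬p ∘ proj₁)
    ... | yes p = map′ (p ,_) proj₂
      (monochromatic? c (mkSubgraph S E′ p) ×-dec connected? (mkSubgraph S E′ p))

    spans-resp : ∀ c S {E₁ E₂} → E₁ ≗ E₂ → Spans c S E₁ → Spans c S E₂
    spans-resp c S {E₁} {E₂} eq (p , (i , mono) , ne , walk) =
      record { E-sym = λ u v → to ∘ E-sym p u v ∘ from
             ; E⊆N   = λ u v → E⊆N p u v ∘ from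
             ; E⊆V   = λ u v → E⊆V p u v ∘ from } ,
      (i , λ u v → mono u v ∘ from) ,
      ne , λ u v u∈ v∈ → Star.map to (walk u v u∈ v∈)
      where
      to : ∀ {u v} → v ∈ E₁ u → v ∈ E₂ u
      to {u} {v} = subst (v ∈_) (eq u)
      from : ∀ {u v} → v ∈ E₂ u → v ∈ E₁ u
      from {u} {v} = subst (v ∈_) (sym (eq u))

    Spanning : EdgeColoring r G → Subset n → Set
    Spanning c S = ∃ (Spans c S)

    spanning? : ∀ c → Decidable (Spanning c)
    spanning? c S = search-Π refl (search-Subset n) n (spans-resp c S) (spans? c S)

    class : ∀ {t} → (Fin n → Fin t) → Fin t → Subset n
    class f i = tabulate λ v → does (f v ≟ i)

    ∈-class⁺ : ∀ {t} (f : Fin n → Fin t) {v i} → f v ≡ i → v ∈ class f i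
    ∈-class⁺ f {v} {i} eq = lookup⇒[]= v _
      (trans (lookup∘tabulate _ v) (dec-true (f v ≟ i) eq))

    ∈-class⁻ : ∀ {t} (f : Fin n → Fin t) {v i} → v ∈ class f i → f v ≡ i
    ∈-class⁻ f {v} {i} v∈
      with f v ≟ i | trans (sym (lookup∘tabulate (λ v → does (f v ≟ i)) v)) ([]=⇒lookup v∈)
    ... | yes eq | _ = eq
    ... | no _   | ()

    spanning-⇔ : ∀ c {S S′} → (∀ v → v ∈ S → v ∈ S′) → (∀ v → v ∈ S′ → v ∈ S) →
                 Spanning c S → Spanning c S′
    spanning-⇔ c to from (E′ , p , mono , (x , x∈) , walk) =
      E′ , record { E-sym = E-sym p ; E⊆N = E⊆N p ; E⊆V = λ u v → to u ∘ E⊆V p u v } ,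
      mono , (x , to x x∈) , λ u v u∈ v∈ → walk u v (from u u∈) (from v v∈)

    Labelling : EdgeColoring r G → ∀ t → (Fin n → Fin t) → Set
    Labelling c t f = ∀ i → Spanning c (class f i)

    labelling-resp : ∀ c t {f g} → f ≗ g → Labelling c t f → Labelling c t g
    labelling-resp c t {f} {g} eq ℓ i = spanning-⇔ c
      (λ v v∈ → ∈-class⁺ g (trans (sym (eq v)) (∈-class⁻ f v∈)))
      (λ v v∈ → ∈-class⁺ f (trans (eq v) (∈-class⁻ g v∈)))
      (ℓ i)

    treePartition? : ∀ (c : EdgeColoring r G) t → Dec (TreePartition c t)
    treePartition? c t = map′ to from
      (search-Π refl (search-Fin t) n (labelling-resp c t)
        (λ f → all? λ i → spanning? c (class f i)))
      where
      to : ∃ (Labelling c t) → TreePartition c t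
      to (f , ℓ) = record
        { H             = λ i → mkSubgraph (class f i) (proj₁ (ℓ i)) (proj₁ (proj₂ (ℓ i)))
        ; monochromatic = λ i → proj₁ (proj₂ (proj₂ (ℓ i)))
        ; connected     = λ i → proj₂ (proj₂ (proj₂ (ℓ i)))
        ; partition     = λ v → f v , ∈-class⁺ f refl , ∈-class⁻ f
        }
      from : TreePartition c t → ∃ (Labelling c t)
      from p = f , λ i → spanning-⇔ c
          (λ v v∈ → ∈-class⁺ f (proj₂ (proj₂ (partition v)) v∈))
          (λ v v∈ → subst (λ i → v ∈ V (H i)) (∈-class⁻ f v∈) (proj₁ (proj₂ (partition v))))
          (E (H i) , isSubgraph (H i) , monochromatic i , connected i)
        where
        open TreePartition p
        f : Fin n → Fin t
        f v = proj₁ (partition v)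

    AtMost : ℕ → EdgeColoring r G → Set
    AtMost s c = ∃[ t ] t ≤ s × TreePartition c t

    atMost? : ∀ s c → Dec (AtMost s c)
    atMost? s c = map′ (λ (t , t<1+s , p) → t , ℕ.≤-pred t<1+s , p)
                       (λ (t , t≤s , p) → t , s≤s t≤s , p)
                       (ℕ.anyUpTo? (treePartition? c) (suc s))

    atMost-resp : ∀ s (c d : EdgeColoring r G) → (∀ u v → color c u v ≡ color d u v) →
                  AtMost s c → AtMost s d
    atMost-resp s c d eq (t , t≤s , p) = t , t≤s , record
      { H             = H
      ; monochromatic = λ i → let (k , mono) = monochromatic i in
                          k , λ u v v∈ → trans (sym (eq u v)) (mono u v v∈)
      ; connected     = connected
      ; partition     = partition
      } where open TreePartition p

    Bad : ℕ → (Fin n → Fin n → Fin r) → Set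
    Bad s f = Σ (∀ u v → f u v ≡ f v u) λ f-sym →
      ¬ AtMost s (record { color = f ; color-sym = f-sym })

    bad? : ∀ s → Decidable (Bad s)
    bad? s f with all? (λ u → all? λ v → f u v ≟ f v u)
    ... | no ¬p = no (¬p ∘ proj₁)
    ... | yes p = map′ (p ,_)
      (λ (q , ¬a) a → ¬a (atMost-resp s _ _ (λ _ _ → refl) a))
      (¬? (atMost? s (record { color = f ; color-sym = p })))

    bad-resp : ∀ s {f g : Fin n → Fin n → Fin r} → (∀ u → f u ≗ g u) → Bad s f → Bad s g
    bad-resp s eq (f-sym , ¬a) =
      (λ u v → trans (sym (eq u v)) (trans (f-sym u v) (eq v u))) ,
      (λ a → ¬a (atMost-resp s _ _ (λ u v → sym (eq u v)) a))

    anyBad? : ∀ s → Dec (∃ (Bad s))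
    anyBad? s =
      search-Π {_≈_ = λ f g → ∀ i → f i ≡ g i} (λ _ → refl)
        (search-Π refl (search-Fin r) n) n (bad-resp s) (bad? s)

    treePartitionable? : Decidable (TreePartitionable r G)
    treePartitionable? s = map′ to from (¬? (anyBad? s))
      where
      to : ¬ ∃ (Bad s) → TreePartitionable r G s
      to none c = decidable-stable (atMost? s c) λ ¬a → none (color c , color-sym c , ¬a)
      from : TreePartitionable r G s → ¬ ∃ (Bad s)
      from all (f , f-sym , ¬a) = ¬a (all _)

    singletons : TreePartitionable r G n
    singletons c = n , ℕ.≤-refl , record
      { H             = λ v → mkSubgraph ⁅ v ⁆ (λ _ → ⊥) record
          { E-sym = λ _ _ e → ⊥-elim (∉⊥ e)
          ; E⊆N   = λ _ _ e → ⊥-elim (∉⊥ e)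
          ; E⊆V   = λ _ _ e → ⊥-elim (∉⊥ e) }
      ; monochromatic = λ v → color c v v , λ _ _ e → ⊥-elim (∉⊥ e)
      ; connected     = λ x → (x , x∈⁅x⁆ x) , λ u v u∈ v∈ →
          subst (Star _ u) (trans (x∈⁅y⁆⇒x≡y x u∈) (sym (x∈⁅y⁆⇒x≡y x v∈))) ε
      ; partition     = λ v → v , x∈⁅x⁆ v , λ v∈ → x∈⁅y⁆⇒x≡y _ v∈
      }

open Existence

minTreePartition : (r : ℕ) {n : ℕ} (G : Graph n) → ∃ (IsMinimum (TreePartitionable r G))
minTreePartition r {n} G = least treePartitionable? n singletons

tp : (r : ℕ) {n : ℕ} → Graph n → ℕ
tp r G = proj₁ (minTreePartition r G)

tp-isMinimum : (r : ℕ) {n : ℕ} (G : Graph n) → IsMinimum (TreePartitionable r G) (tp r G)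
tp-isMinimum r G = proj₂ (minTreePartition r G)

------------------------------------------------------------------------
-- Real numbers, represented by convergent sequences of rationals with
-- arithmetic acting termwise.

infix 4 _<ᴿ_

-- x <ᴿ y says that lim x < lim y: the terms are eventually separated by a
-- fixed positive gap. Termwise x k < y k would only give lim x ≤ lim y.
_<ᴿ_ : (x y : ℕ → ℚ) → Set
x <ᴿ y = ∃[ ε ] 0ℚ ℚ.< ε × ∃[ K ] (∀ k → K ≤ k → x k ℚ.+ ε ℚ.≤ y k)

fromℕ : ℕ → ℚ
fromℕ m = + m ℚ./ 1

1/_! : ℕ → ℚ
1/ k ! = (+ 1 ℚ./ (k !)) {{k ℕ.!≢0}}

-- The partial sums 1/0! + 1/1! + ⋯ + 1/k! of the series for e.
eₖ : ℕ → ℚ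
eₖ zero    = 1/ 0 !
eₖ (suc k) = eₖ k ℚ.+ 1/ (suc k) !

1/!-positive : ∀ k → Positive (1/ k !)
1/!-positive k = ℚ.normalize-pos 1 (k !) {{k ℕ.!≢0}}

eₖ-positive : ∀ k → Positive (eₖ k)
eₖ-positive zero    = 1/!-positive 0
eₖ-positive (suc k) =
  ℚ.pos+pos⇒pos (eₖ k) {{eₖ-positive k}} (1/ (suc k) !) {{1/!-positive (suc k)}}

1/eₖ : ℕ → ℚ
1/eₖ k = (ℚ.1/ eₖ k) {{ℚ.pos⇒nonZero (eₖ k) {{eₖ-positive k}}}}

-- The real number (1 - 1/(e·r!))·n.
threshold : (r n : ℕ) → ℕ → ℚ
threshold r n k = (1ℚ ℚ.- 1/eₖ k ℚ.* 1/ r !) ℚ.* fromℕ n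

{-# OPTIONS --safe #-}

-- Suppose stars with centres x₁, …, xₖ in distinct colours h₁, …, hₖ share a
-- large set A of leaves. If every vertex sends at least t edges to A in the
-- colours h₁, …, hₖ, where t is linear in n, then a random assignment of A to
-- the stars lets, with positive probability, every other vertex reach along a
-- coloured edge a leaf assigned to the star of that colour: this is the tree
-- partition. Otherwise some vertex v sends fewer than t such edges, misses at
-- most d = n - δ(G) vertices of A, and so sends at least (|A| - d - t)/(r - k)
-- edges to A in one of the unused colours: v is the centre of a further star.
-- This process cannot outlast the r colours if n ≥ (d + t) Σ_{j≤r} r!/j!.
-- Since e > Σ_{j≤r+1} 1/j!, the degree condition leaves room for a linear t.

module Submission where

open import Defs
open import Data.Nat
open import Data.Nat.Properties
open import Data.Nat.DivMod using (/-monoˡ-≤; m*n/n≡m; m/n*n≤m; m≡m%n+[m/n]*n; m%n<n)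
open import Data.Nat.ListAction using (sum)
open import Data.Nat.Solver using (module +-*-Solver)
import Data.Integer as ℤ
import Data.Integer.Properties as ℤ
open import Data.Rational as ℚ using (ℚ; 0ℚ; 1ℚ)
import Data.Rational.Properties as ℚ
open import Data.Rational.Unnormalised as ℚᵘ using (mkℚᵘ; *≡*; *≤*) renaming (_≃_ to _≃ᵘ_)
import Data.Rational.Unnormalised.Properties as ℚᵘ
import Data.Rational.Solver as ℚ
open import Data.Bool using (if_then_else_)
open import Data.Fin as Fin using (Fin; zero; suc)
open import Data.Fin.Properties using (all?; any?; ¬∀⟶∃¬; ¬Fin0)
open import Data.Fin.Subset
  using (Subset; _∈_; _⊆_; ∣_∣; ∁; Nonempty; _∩_; _∪_; ⋃; ⊤; inside; outside)
open import Data.Fin.Subset.Properties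
open import Data.Vec using ([]; _∷_; here; there; tabulate)
open import Data.Vec.Properties using (lookup∘tabulate; lookup⇒[]=; []=⇒lookup)
import Data.Vec.Functional as F
open import Data.List.Base as List using (List; []; _∷_; filter; length; allFin)
open import Data.List.Extrema.Nat using (min≤⊤; min≤v⁺)
open import Data.List.Properties using (length-tabulate; length-map)
open import Data.List.Membership.Propositional using (find)
import Data.List.Membership.Propositional as L
open import Data.List.Membership.Propositional.Properties using (∈-allFin)
open import Data.List.Relation.Unary.All as All using (All; []; _∷_)
import Data.List.Relation.Unary.All.Properties as All
import Data.List.Relation.Unary.Any as Any
import Data.List.Relation.Unary.Any.Properties as Any
open import Data.Product using (∃-syntax; _×_; _,_; proj₁; proj₂; map; map₂)
open import Data.Sum as Sum using (_⊎_; inj₁; inj₂)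
open import Data.Empty using (⊥-elim)
open import Function using (_∘_; id)
open import Level using (0ℓ)
open import Relation.Unary using (Pred; Decidable)
open import Relation.Nullary
open import Relation.Nullary.Decidable using (_×-dec_; dec-true)
open import Relation.Binary.Construct.Closure.ReflexiveTransitive using (ε; _◅_; _◅◅_; reverse)
open import Relation.Binary.PropositionalEquality
open import Algebra.Properties.CommutativeMonoid.Sum +-0-commutativeMonoid
  using (∑-distrib-+; sum-cong-≗; sum-replicate-zero) renaming (sum to ∑)

open +-*-Solver using (solve; _:=_; _:+_; _:*_; con)
module R = ℚ.+-*-Solver

-- Satisfying many demands at once

average : ∀ {k} (g : Fin k → ℕ) b → ∑ g < k * b → ∃[ c ] g c < b
average {suc k} g b lt with g zero <? b
... | yes g₀<b = zero , g₀<b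
... | no  g₀≮b = map suc (λ gc<b → gc<b) (average (g ∘ suc) b
  (+-cancelˡ-< b _ _ (≤-<-trans (+-monoˡ-≤ _ (≮⇒≥ g₀≮b)) lt)))

∑-complement : ∀ {k} (S : Subset k) b →
               ∑ (λ c → if does (c ∈? S) then 0 else b) ≡ ∣ ∁ S ∣ * b
∑-complement []            b = refl
∑-complement (inside ∷ S)  b = ∑-complement S b
∑-complement (outside ∷ S) b = cong (b +_) (∑-complement S b)

sum-≤ : ∀ N c {xs} → All (λ x → N * x ≤ c) xs → N * sum xs ≤ length xs * c
sum-≤ N c []                   = ≤-reflexive (*-zeroʳ N)
sum-≤ N c {x ∷ xs} (Nx≤c ∷ ps) = begin
  N * (x + sum xs)    ≡⟨ *-distribˡ-+ N x (sum xs) ⟩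
  N * x + N * sum xs  ≤⟨ +-mono-≤ Nx≤c (sum-≤ N c ps) ⟩
  c + length xs * c   ∎
  where open ≤-Reasoning

nonempty⇒∣∁∣≤ : ∀ {q} (S : Subset (suc q)) → Nonempty S → ∣ ∁ S ∣ ≤ q
nonempty⇒∣∁∣≤ {q} S (x , x∈S) = begin
  ∣ ∁ S ∣        ≡⟨ ∣∁p∣≡n∸∣p∣ S ⟩
  suc q ∸ ∣ S ∣  ≤⟨ ∸-monoʳ-≤ (suc q) (subst (_≤ ∣ S ∣) (∣⁅x⁆∣≡1 x)
                        (p⊆q⇒∣p∣≤∣q∣ (λ y∈ → subst (_∈ S) (sym (x∈⁅y⁆⇒x≡y x y∈)) x∈S))) ⟩
  q                ∎
  where open ≤-Reasoning

-- A demand asks a function f : Fin m → Fin k to satisfy f a ∈ D a for some a.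
Demand : ℕ → ℕ → Set
Demand m k = Fin m → Subset k

Satisfies : ∀ {m k} → (Fin m → Fin k) → Demand m k → Set
Satisfies f D = ∃[ a ] f a ∈ D a

-- The number of functions not satisfying D.
failures : ∀ {m k} → Demand m k → ℕ
failures {zero}  D = 1
failures {suc m} D = ∣ ∁ (D zero) ∣ * failures (D ∘ suc)

totalFailures : ∀ {m k} → List (Demand m k) → ℕ
totalFailures ds = sum (List.map failures ds)

module _ {m k : ℕ} where
  unmet : Fin k → List (Demand (suc m) k) → List (Demand (suc m) k)
  unmet c = filter (λ D → ¬? (c ∈? D zero))

  -- The demands still open once the value at `zero` is fixed to `c`, restated for the remaining
  -- arguments.
  remaining : Fin k → List (Demand (suc m) k) → List (Demand m k)
  remaining c = List.map (_∘ suc) ∘ unmet c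

  -- A demand `D` survives exactly the choices of `c` outside `D zero`, and each of them leaves
  -- `failures (D ∘ suc)` failing functions. This is the average behind the choice of `c` in
  -- `satisfiable`.
  ∑-remaining : ∀ ds → ∑ (λ c → totalFailures (remaining c ds)) ≡ totalFailures ds
  ∑-remaining []       = sum-replicate-zero k
  ∑-remaining (D ∷ ds) = begin
    ∑ (λ c → totalFailures (remaining c (D ∷ ds)))  ≡⟨ sum-cong-≗ split ⟩
    ∑ (λ c → miss c + rest c)                       ≡⟨ ∑-distrib-+ miss rest ⟩
    ∑ miss + ∑ rest                                 ≡⟨ cong₂ _+_ (∑-complement (D zero) _) (∑-remaining ds) ⟩
    failures D + totalFailures ds                   ∎
    where
    open ≡-Reasoning
    miss rest : Fin k → ℕ
    miss c = if does (c ∈? D zero) then 0 else failures (D ∘ suc)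
    rest c = totalFailures (remaining c ds)
    split : ∀ c → totalFailures (remaining c (D ∷ ds)) ≡ miss c + rest c
    split c with c ∈? D zero
    ... | yes _ = refl
    ... | no  _ = refl

  satisfies-∷ : ∀ c (f : Fin m → Fin k) ds → All (Satisfies f) (remaining c ds) →
                All (Satisfies (c F.∷ f)) ds
  satisfies-∷ c f []       ps = []
  satisfies-∷ c f (D ∷ ds) ps with c ∈? D zero
  satisfies-∷ c f (D ∷ ds) ps              | yes c∈ = (zero , c∈) ∷ satisfies-∷ c f ds ps
  satisfies-∷ c f (D ∷ ds) ((a , fa∈) ∷ ps) | no _  = (suc a , fa∈) ∷ satisfies-∷ c f ds ps

-- The method of conditional expectations: the values of f are fixed one at
-- a time, keeping the number of failing extensions below the number of
-- all extensions.
satisfiable : ∀ {m k} (ds : List (Demand m k)) → totalFailures ds < k ^ m →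
              ∃[ f ] All (Satisfies f) ds
satisfiable {zero}  []       _        = (λ ()) , []
satisfiable {zero}  (D ∷ ds) (s≤s ())
satisfiable {suc m} {k} ds lt =
  let c , Φc<   = average _ (k ^ m) (subst (_< k ^ suc m) (sym (∑-remaining ds)) lt)
      f , ps    = satisfiable (remaining c ds) Φc<
  in c F.∷ f , satisfies-∷ c f ds ps

-- A random function fails `D` with probability at most (q/(q+1))^|T|, since every argument in `T`
-- has to avoid at least one of the q+1 values. Denominators are cleared.
failures-≤ : ∀ {m q} (T : Subset m) (D : Demand m (suc q)) →
             (∀ {a} → a ∈ T → Nonempty (D a)) →
             failures D * suc q ^ ∣ T ∣ ≤ q ^ ∣ T ∣ * suc q ^ m
failures-≤ []                    D ne = ≤-refl
failures-≤ {suc m} {q} (inside ∷ T)  D ne = begin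
  ∣ ∁ (D zero) ∣ * φ * (suc q * suc q ^ ∣ T ∣)  ≤⟨ *-monoˡ-≤ _ (*-monoˡ-≤ φ (nonempty⇒∣∁∣≤ (D zero) (ne here))) ⟩
  q * φ * (suc q * suc q ^ ∣ T ∣)               ≡⟨ solve 4 (λ a b c d → a :* b :* (c :* d) := a :* c :* (b :* d)) refl q φ (suc q) (suc q ^ ∣ T ∣) ⟩
  q * suc q * (φ * suc q ^ ∣ T ∣)               ≤⟨ *-monoʳ-≤ (q * suc q) (failures-≤ T (D ∘ suc) (ne ∘ there)) ⟩
  q * suc q * (q ^ ∣ T ∣ * suc q ^ m)           ≡⟨ solve 4 (λ a b c d → a :* b :* (c :* d) := a :* c :* (b :* d)) refl q (suc q) (q ^ ∣ T ∣) (suc q ^ m) ⟩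
  q * q ^ ∣ T ∣ * (suc q * suc q ^ m)           ∎
  where
  open ≤-Reasoning
  φ : ℕ
  φ = failures (D ∘ suc)
failures-≤ {suc m} {q} (outside ∷ T) D ne = begin
  ∣ ∁ (D zero) ∣ * φ * suc q ^ ∣ T ∣  ≤⟨ *-monoˡ-≤ _ (*-monoˡ-≤ φ (∣p∣≤n (∁ (D zero)))) ⟩
  suc q * φ * suc q ^ ∣ T ∣           ≡⟨ *-assoc (suc q) φ _ ⟩
  suc q * (φ * suc q ^ ∣ T ∣)         ≤⟨ *-monoʳ-≤ (suc q) (failures-≤ T (D ∘ suc) (ne ∘ there)) ⟩
  suc q * (q ^ ∣ T ∣ * suc q ^ m)     ≡⟨ solve 3 (λ a b c → a :* (b :* c) := b :* (a :* c)) refl (suc q) (q ^ ∣ T ∣) (suc q ^ m) ⟩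
  q ^ ∣ T ∣ * (suc q * suc q ^ m)     ∎
  where
  open ≤-Reasoning
  φ : ℕ
  φ = failures (D ∘ suc)

-- Each unit of `p` beyond `t` multiplies the left side by `q` and the right side by `suc q`. One
-- bound at `t` thus serves demands of every larger size.
^-growth : ∀ N q {t p} → N * q ^ t < suc q ^ t → t ≤ p → N * q ^ p < suc q ^ p
^-growth N q {t} {p} lt t≤p = subst (λ p → N * q ^ p < suc q ^ p) (m+[n∸m]≡n t≤p) (begin-strict
  N * q ^ (t + e)        ≡⟨ cong (N *_) (^-distribˡ-+-* q t e) ⟩
  N * (q ^ t * q ^ e)    ≡⟨ *-assoc N _ _ ⟨
  N * q ^ t * q ^ e      ≤⟨ *-monoʳ-≤ (N * q ^ t) (^-monoˡ-≤ e (n≤1+n q)) ⟩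
  N * q ^ t * suc q ^ e  <⟨ *-monoˡ-< (suc q ^ e) {{m^n≢0 (suc q) e}} lt ⟩
  suc q ^ t * suc q ^ e  ≡⟨ ^-distribˡ-+-* (suc q) t e ⟨
  suc q ^ (t + e)        ∎)
  where
  open ≤-Reasoning
  e : ℕ
  e = p ∸ t

-- The union bound: each of the `N` demands fails for less than a 1/N share of all functions.
assignment : ∀ {N m q t} (D : Fin N → Demand m (suc q)) (T : Fin N → Subset m) →
             (∀ v {a} → a ∈ T v → Nonempty (D v a)) → (∀ v → t ≤ ∣ T v ∣) →
             N * q ^ t < suc q ^ t →
             ∃[ f ] ∀ v → Satisfies f (D v)
assignment {zero}       D T ne t≤ lt = (λ _ → zero) , λ ()
assignment {N@(suc _)} {m} {q} {t} D T ne t≤ lt =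
  map₂ All.tabulate⁻ (satisfiable ds (begin-strict
    -- The strict bound is carried as `≤ pred K`: it passes through `sum-≤`, and cancelling `N`
    -- leaves a total below `K`.
    totalFailures ds  ≤⟨ *-cancelˡ-≤ N (subst (λ l → N * totalFailures ds ≤ l * pred K)
                                 (trans (length-map failures ds) (length-tabulate D))
                                 (sum-≤ N (pred K) (All.map⁺ (All.tabulate⁺ few)))) ⟩
    pred K            <⟨ pred< ⟩
    K                 ∎))
  where
  open ≤-Reasoning
  ds : List (Demand m (suc q))
  ds = List.tabulate D
  K : ℕ
  K = suc q ^ m
  instance
    K≢0 : NonZero K
    K≢0 = m^n≢0 (suc q) m
  pred< : pred K < K
  pred< = ≤-reflexive (suc-pred K)
  few : ∀ v → N * failures (D v) ≤ pred K
  few v = <⇒≤pred (*-cancelʳ-< (suc q ^ p) (N * failures (D v)) K (begin-strict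
    N * failures (D v) * suc q ^ p    ≡⟨ *-assoc N (failures (D v)) (suc q ^ p) ⟩
    N * (failures (D v) * suc q ^ p)  ≤⟨ *-monoʳ-≤ N (failures-≤ (T v) (D v) (ne v)) ⟩
    N * (q ^ p * K)                   ≡⟨ *-assoc N (q ^ p) K ⟨
    N * q ^ p * K                     <⟨ *-monoˡ-< K (^-growth N q lt (t≤ v)) ⟩
    suc q ^ p * K                     ≡⟨ *-comm (suc q ^ p) K ⟩
    K * suc q ^ p                     ∎))
    where
    p : ℕ
    p = ∣ T v ∣

-- Arithmetic and the number e

-- Bernoulli's inequality (1+1/q)^s ≥ 1+s/q with denominators cleared.
bernoulli : ∀ q s → q ^ s * (q + s) ≤ suc q ^ s * q
bernoulli q zero    = ≤-reflexive (cong (1 *_) (+-identityʳ q))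
bernoulli q (suc s) = begin
  q * q ^ s * (q + suc s)          ≡⟨ solve 3 (λ q s Q → q :* Q :* (q :+ (con 1 :+ s)) := Q :* (q :* (q :+ s) :+ q)) refl q s (q ^ s) ⟩
  q ^ s * (q * (q + s) + q)        ≤⟨ *-monoʳ-≤ (q ^ s) (+-monoʳ-≤ (q * (q + s)) (m≤m+n q s)) ⟩
  q ^ s * (q * (q + s) + (q + s))  ≡⟨ solve 3 (λ q s Q → Q :* (q :* (q :+ s) :+ (q :+ s)) := (con 1 :+ q) :* (Q :* (q :+ s))) refl q s (q ^ s) ⟩
  suc q * (q ^ s * (q + s))        ≤⟨ *-monoʳ-≤ (suc q) (bernoulli q s) ⟩
  suc q * (suc q ^ s * q)          ≡⟨ *-assoc (suc q) (suc q ^ s) q ⟨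
  suc q * suc q ^ s * q            ∎
  where open ≤-Reasoning

-- Bernoulli's inequality on each half of the exponent gives (1+1/q)^(2s) ≥ (1+s/q)^2. A quadratic
-- bound is enough because `s` will be linear in `n`.
quadratic⇒exponential : ∀ n q s .{{_ : NonZero q}} → n * (q * q) < (q + s) * (q + s) →
                        n * q ^ (s + s) < suc q ^ (s + s)
quadratic⇒exponential n q s lt = *-cancelʳ-< (q * q) _ _ (begin-strict
  n * q ^ (s + s) * (q * q)            ≡⟨ cong (λ p → n * p * (q * q)) (^-distribˡ-+-* q s s) ⟩
  n * (q ^ s * q ^ s) * (q * q)        ≡⟨ solve 3 (λ n Q p → n :* (Q :* Q) :* p := n :* p :* (Q :* Q)) refl n (q ^ s) (q * q) ⟩
  n * (q * q) * (q ^ s * q ^ s)        <⟨ *-monoˡ-< (q ^ s * q ^ s) {{m*n≢0 (q ^ s) (q ^ s) {{m^n≢0 q s}} {{m^n≢0 q s}}}} lt ⟩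
  (q + s) * (q + s) * (q ^ s * q ^ s)  ≡⟨ solve 2 (λ p Q → p :* p :* (Q :* Q) := Q :* p :* (Q :* p)) refl (q + s) (q ^ s) ⟩
  q ^ s * (q + s) * (q ^ s * (q + s))  ≤⟨ *-mono-≤ (bernoulli q s) (bernoulli q s) ⟩
  suc q ^ s * q * (suc q ^ s * q)      ≡⟨ solve 2 (λ P q → P :* q :* (P :* q) := P :* P :* (q :* q)) refl (suc q ^ s) q ⟩
  suc q ^ s * suc q ^ s * (q * q)      ≡⟨ cong (_* (q * q)) (^-distribˡ-+-* (suc q) s s) ⟨
  suc q ^ (s + s) * (q * q)            ∎)
  where open ≤-Reasoning

-- From this size on, `s = n / (2 * B)` is at least 4Br², which makes s² outgrow the union bound.
sizeBound : ℕ → ℕ → ℕ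
sizeBound r B = 4 * (B * (r * r)) * (2 * B)

-- Linear t beats the union bound over n vertices.
linear-size : ∀ r B n .{{_ : NonZero r}} .{{_ : NonZero B}} → sizeBound r B ≤ n →
              ∃[ t ] 0 < t × B * t ≤ n × (∀ q → q ≤ r → n * q ^ t < suc q ^ t)
linear-size r B n bound≤n = s + s , +-mono-≤ 0<s z≤n , fits , beats
  where
  open ≤-Reasoning
  instance
    2B≢0 : NonZero (2 * B)
    2B≢0 = m*n≢0 2 B
    r²≢0 : NonZero (r * r)
    r²≢0 = m*n≢0 r r
    Br²≢0 : NonZero (B * (r * r))
    Br²≢0 = m*n≢0 B (r * r)
    bound≢0 : NonZero (4 * (B * (r * r)))
    bound≢0 = m*n≢0 4 (B * (r * r))
  s : ℕ
  s = n / (2 * B)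
  s-large : 4 * (B * (r * r)) ≤ s
  s-large = subst (_≤ s) (m*n/n≡m (4 * (B * (r * r))) (2 * B)) (/-monoˡ-≤ (2 * B) bound≤n)
  0<s : 0 < s
  0<s = ≤-trans (>-nonZero⁻¹ (4 * (B * (r * r)))) s-large
  fits : B * (s + s) ≤ n
  fits = begin
    B * (s + s)  ≡⟨ solve 2 (λ B s → B :* (s :+ s) := s :* (con 2 :* B)) refl B s ⟩
    s * (2 * B)  ≤⟨ m/n*n≤m n (2 * B) ⟩
    n            ∎
  n≤ : n ≤ (1 + s) * (2 * B)
  n≤ = begin
    n                          ≡⟨ m≡m%n+[m/n]*n n (2 * B) ⟩
    n % (2 * B) + s * (2 * B)  ≤⟨ +-monoˡ-≤ (s * (2 * B)) (<⇒≤ (m%n<n n (2 * B))) ⟩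
    (1 + s) * (2 * B)          ∎
  beats : ∀ q → q ≤ r → n * q ^ (s + s) < suc q ^ (s + s)
  -- The case of a single star: the left side vanishes because the exponent is positive.
  beats zero q≤r = begin-strict
    n * 0 ^ (s + s)  ≡⟨ cong (n *_) (0^ (+-mono-≤ 0<s z≤n)) ⟩
    n * 0            ≡⟨ *-zeroʳ n ⟩
    0                <⟨ m^n>0 1 (s + s) ⟩
    1 ^ (s + s)      ∎
    where
    0^ : ∀ {t} → 0 < t → 0 ^ t ≡ 0
    0^ (s≤s _) = refl
  beats q@(suc _) q≤r = quadratic⇒exponential n q s (begin-strict
    n * (q * q)                  ≤⟨ *-monoˡ-≤ (q * q) n≤ ⟩
    -- `0<s` trades `1 + s` for `s + s`; then n q² ≤ s (4Bq²) ≤ s² by `s-large`.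
    (1 + s) * (2 * B) * (q * q)  ≤⟨ *-monoˡ-≤ (q * q) (*-monoˡ-≤ (2 * B) (+-monoˡ-≤ s 0<s)) ⟩
    (s + s) * (2 * B) * (q * q)  ≡⟨ solve 3 (λ s B p → (s :+ s) :* (con 2 :* B) :* p := s :* (con 4 :* (B :* p))) refl s B (q * q) ⟩
    s * (4 * (B * (q * q)))      ≤⟨ *-monoʳ-≤ s (≤-trans (*-monoʳ-≤ 4 (*-monoʳ-≤ B (*-mono-≤ q≤r q≤r))) s-large) ⟩
    s * s                        <⟨ *-mono-< s<q+s s<q+s ⟩
    (q + s) * (q + s)            ∎)
    where
    s<q+s : s < q + s
    s<q+s = m<n+m s {q} z<s

-- e! k = k! (1/0! + 1/1! + ⋯ + 1/k!)
e! : ℕ → ℕ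
e! zero    = 1
e! (suc k) = suc k * e! k + 1

e!≢0 : ∀ k → NonZero (e! k)
e!≢0 zero    = _
e!≢0 (suc k) = >-nonZero (m≤n+m 1 (suc k * e! k))

-- Natural numbers as rationals, and the degree condition

toℚᵘ-fromℕ : ∀ m → ℚ.toℚᵘ (fromℕ m) ≃ᵘ mkℚᵘ (ℤ.+ m) 0
toℚᵘ-fromℕ m = ℚ.toℚᵘ-fromℚᵘ (mkℚᵘ (ℤ.+ m) 0)

-- Moved to unnormalised fractions, where it is cross multiplication; normalised ones do not compute
-- on variables.
fromℕ-+ : ∀ a b → fromℕ (a + b) ≡ fromℕ a ℚ.+ fromℕ b
fromℕ-+ a b = ℚ.toℚᵘ-injective (begin
  ℚ.toℚᵘ (fromℕ (a + b))                  ≈⟨ toℚᵘ-fromℕ (a + b) ⟩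
  mkℚᵘ (ℤ.+ (a + b)) 0                    ≈⟨ *≡* (cong (ℤ._* ℤ.+ 1) (sym (cong₂ ℤ._+_ (ℤ.*-identityʳ (ℤ.+ a)) (ℤ.*-identityʳ (ℤ.+ b))))) ⟩
  mkℚᵘ (ℤ.+ a) 0 ℚᵘ.+ mkℚᵘ (ℤ.+ b) 0      ≈⟨ ℚᵘ.+-cong (toℚᵘ-fromℕ a) (toℚᵘ-fromℕ b) ⟨
  ℚ.toℚᵘ (fromℕ a) ℚᵘ.+ ℚ.toℚᵘ (fromℕ b)  ≈⟨ ℚ.toℚᵘ-homo-+ (fromℕ a) (fromℕ b) ⟨
  ℚ.toℚᵘ (fromℕ a ℚ.+ fromℕ b)            ∎)
  where open import Relation.Binary.Reasoning.Setoid ℚᵘ.≃-setoid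

fromℕ-* : ∀ a b → fromℕ (a * b) ≡ fromℕ a ℚ.* fromℕ b
fromℕ-* a b = ℚ.toℚᵘ-injective (begin
  ℚ.toℚᵘ (fromℕ (a * b))                  ≈⟨ toℚᵘ-fromℕ (a * b) ⟩
  mkℚᵘ (ℤ.+ (a * b)) 0                    ≈⟨ *≡* (cong (ℤ._* ℤ.+ 1) (ℤ.pos-* a b)) ⟩
  mkℚᵘ (ℤ.+ a) 0 ℚᵘ.* mkℚᵘ (ℤ.+ b) 0      ≈⟨ ℚᵘ.*-cong (toℚᵘ-fromℕ a) (toℚᵘ-fromℕ b) ⟨
  ℚ.toℚᵘ (fromℕ a) ℚᵘ.* ℚ.toℚᵘ (fromℕ b)  ≈⟨ ℚ.toℚᵘ-homo-* (fromℕ a) (fromℕ b) ⟨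
  ℚ.toℚᵘ (fromℕ a ℚ.* fromℕ b)            ∎)
  where open import Relation.Binary.Reasoning.Setoid ℚᵘ.≃-setoid

fromℕ-*-1/ : ∀ m .{{_ : NonZero m}} → fromℕ m ℚ.* (ℤ.+ 1 ℚ./ m) ≡ 1ℚ
fromℕ-*-1/ m@(suc m-1) = ℚ.toℚᵘ-injective (begin
  ℚ.toℚᵘ (fromℕ m ℚ.* (ℤ.+ 1 ℚ./ m))          ≈⟨ ℚ.toℚᵘ-homo-* (fromℕ m) (ℤ.+ 1 ℚ./ m) ⟩
  ℚ.toℚᵘ (fromℕ m) ℚᵘ.* ℚ.toℚᵘ (ℤ.+ 1 ℚ./ m)  ≈⟨ ℚᵘ.*-cong (toℚᵘ-fromℕ m) (ℚ.toℚᵘ-fromℚᵘ (mkℚᵘ (ℤ.+ 1) m-1)) ⟩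
  mkℚᵘ (ℤ.+ m) 0 ℚᵘ.* mkℚᵘ (ℤ.+ 1) m-1        ≈⟨ *≡* (cong ℤ.+_ (solve 1 (λ m → m :* con 1 :* con 1 := con 1 :* (con 1 :* m)) refl m)) ⟩
  ℚᵘ.1ℚᵘ                                      ∎)
  where open import Relation.Binary.Reasoning.Setoid ℚᵘ.≃-setoid

fromℕ-cancel-≤ : ∀ {a b} → fromℕ a ℚ.≤ fromℕ b → a ≤ b
fromℕ-cancel-≤ {a} {b} a≤b
  with ℚᵘ.≤-respʳ-≃ (toℚᵘ-fromℕ b) (ℚᵘ.≤-respˡ-≃ (toℚᵘ-fromℕ a) (ℚ.toℚᵘ-mono-≤ a≤b))
... | *≤* p = ℤ.drop‿+≤+ (subst₂ ℤ._≤_ (ℤ.*-identityʳ (ℤ.+ a)) (ℤ.*-identityʳ (ℤ.+ b)) p)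

fromℕ-nonNeg : ∀ m → ℚ.NonNegative (fromℕ m)
fromℕ-nonNeg m = ℚ.normalize-nonNeg m 1

-- Multiplying the recursion of `eₖ` by (k+1)! gives the recursion of `e!`.
fromℕ-e! : ∀ k → fromℕ (e! k) ≡ eₖ k ℚ.* fromℕ (k !)
fromℕ-e! zero    = refl
fromℕ-e! (suc k) = begin
  fromℕ (suc k * e! k + 1)               ≡⟨ fromℕ-+ (suc k * e! k) 1 ⟩
  fromℕ (suc k * e! k) ℚ.+ 1ℚ            ≡⟨ cong (ℚ._+ 1ℚ) (fromℕ-* (suc k) (e! k)) ⟩
  fromℕ (suc k) ℚ.* fromℕ (e! k) ℚ.+ 1ℚ  ≡⟨ cong₂ (λ x y → fromℕ (suc k) ℚ.* x ℚ.+ y) (fromℕ-e! k)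
                                                                         (sym (fromℕ-*-1/ (suc k !) {{suc k !≢0}})) ⟩
  fromℕ (suc k) ℚ.* (eₖ k ℚ.* fromℕ (k !)) ℚ.+ fromℕ (suc k !) ℚ.* 1/ suc k !
                                                                    ≡⟨ cong (λ x → fromℕ (suc k) ℚ.* (eₖ k ℚ.* fromℕ (k !)) ℚ.+ x ℚ.* 1/ suc k !) (fromℕ-* (suc k) (k !)) ⟩
  fromℕ (suc k) ℚ.* (eₖ k ℚ.* fromℕ (k !)) ℚ.+ fromℕ (suc k) ℚ.* fromℕ (k !) ℚ.* 1/ suc k !
                                                                    ≡⟨ R.solve 4 (λ m x f i → m R.:* (x R.:* f) R.:+ m R.:* f R.:* i R.:= (x R.:+ i) R.:* (m R.:* f)) refl
                                                                         (fromℕ (suc k)) (eₖ k) (fromℕ (k !)) (1/ suc k !) ⟩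
  eₖ (suc k) ℚ.* (fromℕ (suc k) ℚ.* fromℕ (k !))  ≡⟨ cong (eₖ (suc k) ℚ.*_) (fromℕ-* (suc k) (k !)) ⟨
  eₖ (suc k) ℚ.* fromℕ (suc k !)                  ∎
  where open ≡-Reasoning

eₖ-mono : ∀ j k → eₖ k ℚ.≤ eₖ (j + k)
eₖ-mono zero    k = ℚ.≤-refl
eₖ-mono (suc j) k = begin
  eₖ k               ≤⟨ eₖ-mono j k ⟩
  eₖ (j + k)         ≡⟨ ℚ.+-identityʳ _ ⟨
  eₖ (j + k) ℚ.+ 0ℚ  ≤⟨ ℚ.+-monoʳ-≤ (eₖ (j + k)) (ℚ.<⇒≤ (ℚ.positive⁻¹ _ {{1/!-positive (suc (j + k))}})) ⟩
  eₖ (suc (j + k))   ∎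
  where open ℚ.≤-Reasoning

-- The degree condition bounds (n-δ)·`eₖ k`·r! by n for large k. Truncating the series after
-- 1/(r+1)! weakens this, and multiplying by r+1 makes the coefficient the integer `e! (suc r)`. The
-- term 1/(r+1)! is what later pays for `t`.
threshold⇒ : ∀ r {n δ} → δ ≤ n → threshold r n <ᴿ (λ _ → fromℕ δ) →
             e! (suc r) * (n ∸ δ) ≤ suc r * n
threshold⇒ r {n} {δ} δ≤n (γ , 0<γ , K , gap) = fromℕ-cancel-≤ (begin
  fromℕ (e! (suc r) * d)                ≡⟨ fromℕ-* (e! (suc r)) d ⟩
  fromℕ (e! (suc r)) ℚ.* D              ≡⟨ cong (ℚ._* D) (fromℕ-e! (suc r)) ⟩
  eₖ (suc r) ℚ.* fromℕ (suc r !) ℚ.* D  ≡⟨ cong (λ x → eₖ (suc r) ℚ.* x ℚ.* D) (fromℕ-* (suc r) (r !)) ⟩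
  eₖ (suc r) ℚ.* (S ℚ.* f) ℚ.* D        ≡⟨ R.solve 4 (λ e s f d → e R.:* (s R.:* f) R.:* d R.:= (s R.:* f R.:* d) R.:* e) refl (eₖ (suc r)) S f D ⟩
  (S ℚ.* f ℚ.* D) ℚ.* eₖ (suc r)        ≤⟨ ℚ.*-monoˡ-≤-nonNeg (S ℚ.* f ℚ.* D) (eₖ-mono K (suc r)) ⟩
  (S ℚ.* f ℚ.* D) ℚ.* e                 ≤⟨ ℚ.*-monoʳ-≤-nonNeg e (ℚ.*-monoˡ-≤-nonNeg (S ℚ.* f) D≤xn) ⟩
  (S ℚ.* f ℚ.* (x ℚ.* fromℕ n)) ℚ.* e   ≡⟨ R.solve 6 (λ s f i j n e → (s R.:* f R.:* (i R.:* j R.:* n)) R.:* e R.:= (e R.:* i) R.:* (f R.:* j) R.:* (s R.:* n)) refl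
                                                       S f (1/eₖ k) (1/ r !) (fromℕ n) e ⟩
  (e ℚ.* 1/eₖ k) ℚ.* (f ℚ.* 1/ r !) ℚ.* (S ℚ.* fromℕ n)
                                                  ≡⟨ cong₂ (λ x y → x ℚ.* y ℚ.* (S ℚ.* fromℕ n)) (ℚ.*-inverseʳ e {{ℚ.pos⇒nonZero e {{eₖ-positive k}}}}) (fromℕ-*-1/ (r !) {{r !≢0}}) ⟩
  1ℚ ℚ.* 1ℚ ℚ.* (S ℚ.* fromℕ n)  ≡⟨ ℚ.*-identityˡ (S ℚ.* fromℕ n) ⟩
  S ℚ.* fromℕ n                  ≡⟨ fromℕ-* (suc r) n ⟨
  fromℕ (suc r * n)              ∎)
  where
  open ℚ.≤-Reasoning
  k d : ℕ
  -- From `K` on the gap is available, and from `suc r` on the partial sum is at least `eₖ (suc r)`.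
  k = K + suc r
  d = n ∸ δ
  D S f e x : ℚ
  D = fromℕ d
  S = fromℕ (suc r)
  f = fromℕ (r !)
  e = eₖ k
  x = 1/eₖ k ℚ.* 1/ r !
  instance
    S-nonNeg : ℚ.NonNegative S
    S-nonNeg = fromℕ-nonNeg (suc r)
    f-nonNeg : ℚ.NonNegative f
    f-nonNeg = fromℕ-nonNeg (r !)
    D-nonNeg : ℚ.NonNegative D
    D-nonNeg = fromℕ-nonNeg d
    e-nonNeg : ℚ.NonNegative e
    e-nonNeg = ℚ.pos⇒nonNeg e {{eₖ-positive k}}
    Sf-nonNeg : ℚ.NonNegative (S ℚ.* f)
    Sf-nonNeg = ℚ.nonNeg*nonNeg⇒nonNeg S f
    SfD-nonNeg : ℚ.NonNegative (S ℚ.* f ℚ.* D)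
    SfD-nonNeg = ℚ.nonNeg*nonNeg⇒nonNeg (S ℚ.* f) D
  t : ℚ
  t = threshold r n k
  t≤δ : t ℚ.≤ fromℕ δ
  t≤δ = begin
    t         ≡⟨ ℚ.+-identityʳ t ⟨
    t ℚ.+ 0ℚ  ≤⟨ ℚ.+-monoʳ-≤ t (ℚ.<⇒≤ 0<γ) ⟩
    t ℚ.+ γ   ≤⟨ gap k (m≤m+n K (suc r)) ⟩
    fromℕ δ   ∎
  D≤xn : D ℚ.≤ x ℚ.* fromℕ n
  D≤xn = begin
    D                          ≡⟨ R.solve 2 (λ D δ → D R.:= D R.:+ δ R.:- δ) refl D (fromℕ δ) ⟩
    D ℚ.+ fromℕ δ ℚ.- fromℕ δ  ≡⟨ cong (ℚ._- fromℕ δ) (fromℕ-+ d δ) ⟨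
    fromℕ (d + δ) ℚ.- fromℕ δ  ≡⟨ cong (λ m → fromℕ m ℚ.- fromℕ δ) (m∸n+n≡m δ≤n) ⟩
    fromℕ n ℚ.- fromℕ δ        ≤⟨ ℚ.+-monoʳ-≤ (fromℕ n) (ℚ.neg-antimono-≤ t≤δ) ⟩
    fromℕ n ℚ.- t              ≡⟨ R.solve 2 (λ n x → n R.:- (R.con 1ℚ R.:- x) R.:* n R.:= x R.:* n) refl (fromℕ n) x ⟩
    x ℚ.* fromℕ n              ∎

-- Growing stars

module _ {n : ℕ} {P : Pred (Fin n) 0ℓ} (P? : Decidable P) where

  comprehension : Subset n
  comprehension = tabulate (λ v → does (P? v))

  ∈-comprehension⁺ : ∀ {v} → P v → v ∈ comprehension
  ∈-comprehension⁺ {v} p = lookup⇒[]= v _ (trans (lookup∘tabulate _ v) (dec-true (P? v) p))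

  ∈-comprehension⁻ : ∀ {v} → v ∈ comprehension → P v
  ∈-comprehension⁻ {v} v∈
    with P? v | trans (sym (lookup∘tabulate (λ v → does (P? v)) v)) ([]=⇒lookup v∈)
  ... | yes p | _  = p
  ... | no _  | ()

∣p∪q∣≤∣p∣+∣q∣ : ∀ {n} (p q : Subset n) → ∣ p ∪ q ∣ ≤ ∣ p ∣ + ∣ q ∣
∣p∪q∣≤∣p∣+∣q∣ []            []            = z≤n
∣p∪q∣≤∣p∣+∣q∣ (outside ∷ p) (outside ∷ q) = ∣p∪q∣≤∣p∣+∣q∣ p q
∣p∪q∣≤∣p∣+∣q∣ (outside ∷ p) (inside ∷ q)  =
  ≤-trans (s≤s (∣p∪q∣≤∣p∣+∣q∣ p q)) (≤-reflexive (sym (+-suc ∣ p ∣ ∣ q ∣)))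
∣p∪q∣≤∣p∣+∣q∣ (inside ∷ p)  (outside ∷ q) = s≤s (∣p∪q∣≤∣p∣+∣q∣ p q)
∣p∪q∣≤∣p∣+∣q∣ (inside ∷ p)  (inside ∷ q)  =
  s≤s (≤-trans (∣p∪q∣≤∣p∣+∣q∣ p q) (+-monoʳ-≤ ∣ p ∣ (n≤1+n ∣ q ∣)))

∣⋃∣≤ : ∀ {n} {I : Set} (S : I → Subset n) b {is} → All (λ i → ∣ S i ∣ ≤ b) is →
       ∣ ⋃ (List.map S is) ∣ ≤ length is * b
∣⋃∣≤ {n} S b []            = ≤-reflexive (∣⊥∣≡0 n)
∣⋃∣≤ S b {i ∷ is} (p ∷ ps) =
  ≤-trans (∣p∪q∣≤∣p∣+∣q∣ (S i) _) (+-mono-≤ p (∣⋃∣≤ S b ps))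

∈-⋃⁺ : ∀ {n} {I : Set} (S : I → Subset n) {i is v} → i L.∈ is → v ∈ S i →
       v ∈ ⋃ (List.map S is)
∈-⋃⁺ S (Any.here refl) v∈ = x∈p∪q⁺ (inj₁ v∈)
∈-⋃⁺ S (Any.there i∈)  v∈ = x∈p∪q⁺ (inj₂ (∈-⋃⁺ S i∈ v∈))

∣p∣>0⇒nonempty : ∀ {n} (p : Subset n) → 0 < ∣ p ∣ → Nonempty p
∣p∣>0⇒nonempty {n} p lt with nonempty? p
... | yes ne = ne
... | no  ¬ne = ⊥-elim (<-irrefl (sym (trans (cong ∣_∣ (Empty-unique ¬ne)) (∣⊥∣≡0 n))) lt)

extract : ∀ {A : Set} {x : A} {xs} → x L.∈ xs →
          ∃[ ys ] length xs ≡ suc (length ys) × (∀ {y} → y L.∈ xs → y ≡ x ⊎ y L.∈ ys)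
extract {xs = x ∷ xs} (Any.here refl) = xs , refl , λ where
  (Any.here eq)  → inj₁ eq
  (Any.there y∈) → inj₂ y∈
extract {xs = z ∷ xs} (Any.there x∈) =
  let ys , len , cover = extract x∈ in z ∷ ys , cong suc len , λ where
    (Any.here eq)  → inj₂ (Any.here eq)
    (Any.there y∈) → Sum.map₂ Any.there (cover y∈)

-- Stars with common leaves and the tree partition they yield

module _ {n : ℕ} {G : Graph n} {r : ℕ} (c : EdgeColoring r G) where

  Adjacent : Fin r → Fin n → Fin n → Set
  Adjacent h u v = v ∈ N G u × color c u v ≡ h

  adjacent? : ∀ h u → Decidable (Adjacent h u)
  adjacent? h u v = (v ∈? N G u) ×-dec (color c u v Fin.≟ h)

  adjacent-sym : ∀ {h u v} → Adjacent h u v → Adjacent h v u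
  adjacent-sym {h} {u} {v} (v∈N , eq) = N-sym G v∈N , trans (color-sym c v u) eq

  neighbours : Fin r → Fin n → Subset n
  neighbours h u = comprehension (adjacent? h u)

  -- All stars share one set of leaves, which is divided among them only at the end; until then each
  -- new star cuts it down.
  record Stars (k : ℕ) : Set where
    field
      centre    : Fin k → Fin n
      injective : ∀ {i j} → centre i ≡ centre j → i ≡ j
      hue       : Fin k → Fin r
      leaves    : Subset n
      joined    : ∀ i {a} → a ∈ leaves → Adjacent (hue i) (centre i) a

    -- If the leaf `a` is assigned to star `i`, then `v` can join that star through `a`.
    Reaches : Fin n → Fin n → Fin k → Set
    Reaches v a i = a ∈ leaves × Adjacent (hue i) v a

    reaches? : ∀ v a → Decidable (Reaches v a)
    reaches? v a i = (a ∈? leaves) ×-dec adjacent? (hue i) v a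

    linked? : ∀ v → Decidable (λ a → ∃[ i ] Reaches v a i)
    linked? v a = any? (reaches? v a)

    linked : Fin n → Subset n
    linked v = comprehension (linked? v)

  module _ {k} (S : Stars k) (f : Fin n → Fin k)
           (f-reaches : ∀ v → ∃[ a ] Stars.Reaches S v a (f a)) where

    open Stars S

    -- The reason for the label of `v`, from which `to-centre` reads off a path with zero, one or
    -- two edges.
    data Kind (v : Fin n) : Fin k → Set where
      isCentre : ∀ {i} → v ≡ centre i → Kind v i
      isLeaf   : v ∈ leaves → Kind v (f v)
      isOther  : ∀ {a} → Reaches v a (f a) → Kind v (f a)

    -- A leaf is adjacent to every centre, and the graph has no loops. So the test for centres,
    -- which `kind` makes first, never catches a leaf.
    leaf≢centre : ∀ {a} → a ∈ leaves → ∀ i → a ≢ centre i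
    leaf≢centre a∈ i refl = N-irrefl G (proj₁ (joined i a∈))

    kind : ∀ v → ∃[ i ] Kind v i
    kind v with any? (λ i → v Fin.≟ centre i) | v ∈? leaves
    ... | yes (i , v≡) | _      = i , isCentre v≡
    ... | no _         | yes v∈ = f v , isLeaf v∈
    ... | no _         | no _   = f (proj₁ (f-reaches v)) , isOther (proj₂ (f-reaches v))

    label : Fin n → Fin k
    label v = proj₁ (kind v)

    labelled? : ∀ i → Decidable (λ v → label v ≡ i)
    labelled? i v = label v Fin.≟ i

    label-centre : ∀ i → label (centre i) ≡ i
    label-centre i with any? (λ j → centre i Fin.≟ centre j) | centre i ∈? leaves
    ... | yes (j , eq) | _ = injective (sym eq)
    ... | no ¬∃        | _ = ⊥-elim (¬∃ (i , refl))

    label-leaf : ∀ {a} → a ∈ leaves → label a ≡ f a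
    label-leaf {a} a∈ with any? (λ j → a Fin.≟ centre j) | a ∈? leaves
    ... | yes (j , eq) | _     = ⊥-elim (leaf≢centre a∈ j eq)
    ... | no _         | yes _ = refl
    ... | no _         | no a∉ = ⊥-elim (a∉ a∈)

    -- All edges of the star's colour inside its class are kept; connectedness then only asks for a
    -- walk from each vertex to the centre.
    Edge : Fin k → Fin n → Fin n → Set
    Edge i u v = label u ≡ i × label v ≡ i × Adjacent (hue i) u v

    edge? : ∀ i u → Decidable (Edge i u)
    edge? i u v = (label u Fin.≟ i) ×-dec ((label v Fin.≟ i) ×-dec adjacent? (hue i) u v)

    edge-sym : ∀ {i u v} → Edge i u v → Edge i v u
    edge-sym (u≡ , v≡ , v∈) = v≡ , u≡ , adjacent-sym v∈

    tree : Fin k → Subgraph G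
    tree i = mkSubgraph (comprehension (labelled? i)) (λ u → comprehension (edge? i u)) record
      { E-sym = λ u v v∈ → ∈-comprehension⁺ (edge? i v) (edge-sym (∈-comprehension⁻ (edge? i u) v∈))
      ; E⊆N   = λ u v v∈ → proj₁ (proj₂ (proj₂ (∈-comprehension⁻ (edge? i u) v∈)))
      ; E⊆V   = λ u v v∈ → ∈-comprehension⁺ (labelled? _) (proj₁ (∈-comprehension⁻ (edge? i u) v∈))
      }

    step : ∀ {i u v} → Edge i u v → Walk (tree i) u v
    step {i} {u} uv = ∈-comprehension⁺ (edge? i u) uv ◅ ε

    leaf-to-centre : ∀ {a} → a ∈ leaves → Walk (tree (f a)) a (centre (f a))
    leaf-to-centre {a} a∈ =
      step (label-leaf a∈ , label-centre (f a) , adjacent-sym (joined (f a) a∈))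

    to-centre : ∀ {i} v → label v ≡ i → Walk (tree i) v (centre i)
    to-centre v refl with kind v in eq
    ... | i      , isCentre refl             = ε
    ... | .(f v) , isLeaf v∈                 = leaf-to-centre v∈
    -- `eq` retains `label v ≡ f a`, so the edge from `v` to the leaf `a` stays inside one class.
    ... | .(f a) , isOther {a} (a∈ , a∈N)    =
      step (cong proj₁ eq , label-leaf a∈ , a∈N) ◅◅ leaf-to-centre a∈

    stars⇒treePartition : TreePartition c k
    stars⇒treePartition = record
      { H             = tree
      ; monochromatic = λ i → hue i , λ u v v∈ →
          proj₂ (proj₂ (proj₂ (∈-comprehension⁻ (edge? i u) v∈)))
      ; connected     = λ i → (centre i , ∈-comprehension⁺ (labelled? _) (label-centre i)) , λ u v u∈ v∈ →
          to-centre u (∈-comprehension⁻ (labelled? _) u∈) ◅◅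
          reverse (λ {u} {v} → E-sym (isSubgraph (tree i)) u v)
            (to-centre v (∈-comprehension⁻ (labelled? _) v∈))
      ; partition     = λ v → label v , ∈-comprehension⁺ (labelled? _) refl , ∈-comprehension⁻ (labelled? _)
      }

  -- The demand of `v` at a leaf `a` is the set of stars that would serve `v` if they received `a`.
  -- It is nonempty for the `a` in `linked v`, so `assignment` distributes the leaves.
  linked⇒treePartition : ∀ {k t} (S : Stars k) → 0 < t → (∀ v → t ≤ ∣ Stars.linked S v ∣) →
                         (∀ q → q < k → n * q ^ t < suc q ^ t) → TreePartition c k
  -- Without stars nothing is linked, so `0 < t` forces the graph to have no vertices.
  linked⇒treePartition {zero} S 0<t t≤ beats = stars⇒treePartition S
    absurd (λ v → ⊥-elim (¬Fin0 (absurd v)))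
    where
    open Stars S
    absurd : Fin n → Fin 0
    absurd v = proj₁ (∈-comprehension⁻ (linked? v)
      (proj₂ (∣p∣>0⇒nonempty (linked v) (≤-trans 0<t (t≤ v)))))
  linked⇒treePartition {suc q} S 0<t t≤ beats =
    let f , sat = assignment (λ v a → comprehension (reaches? v a)) linked
                    (λ v a∈ → map₂ (∈-comprehension⁺ (reaches? v _)) (∈-comprehension⁻ (linked? v) a∈))
                    t≤ (beats q ≤-refl)
    in stars⇒treePartition S f (λ v → map₂ (∈-comprehension⁻ (reaches? v _)) (sat v))
    where open Stars S

  -- Adding stars until every vertex is well linked

  module _ {d t : ℕ} (nonNeighbours≤d : ∀ v → ∣ ∁ (N G v) ∣ ≤ d) where

    private
      D : ℕ
      D = d + t

    module _ {k} (S : Stars k) where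
      open Stars S

      -- An existing centre is linked to every leaf, so `few` makes `v` a new centre.
      extend : ∀ v h → ∣ linked v ∣ < ∣ leaves ∣ → Stars (suc k)
      extend v h few = record
        { centre    = v F.∷ centre
        ; injective = inj _ _
        ; hue       = h F.∷ hue
        ; leaves    = leaves ∩ neighbours h v
        ; joined    = λ where
            zero    a∈ → ∈-comprehension⁻ (adjacent? h v) (p∩q⊆q leaves _ a∈)
            (suc i) a∈ → joined i (p∩q⊆p leaves _ a∈)
        }
        where
        v≢centre : ∀ i → v ≢ centre i
        v≢centre i refl = <⇒≱ few (p⊆q⇒∣p∣≤∣q∣ λ a∈ →
          ∈-comprehension⁺ (linked? v) (i , a∈ , joined i a∈))
        inj : ∀ i j → (v F.∷ centre) i ≡ (v F.∷ centre) j → i ≡ j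
        inj zero    zero    eq = refl
        inj zero    (suc j) eq = ⊥-elim (v≢centre j eq)
        inj (suc i) zero    eq = ⊥-elim (v≢centre i (sym eq))
        inj (suc i) (suc j) eq = cong suc (injective eq)

      -- A leaf is either a non-neighbour of `v`, or joined to `v` in a used colour and hence
      -- linked, or joined to `v` in a colour from `L`.
      ∣leaves∣≤ : ∀ {L} → (∀ h → (∃[ i ] hue i ≡ h) ⊎ h L.∈ L) →
                  ∀ v b → All (λ h → ∣ leaves ∩ neighbours h v ∣ ≤ b) L →
                  ∣ leaves ∣ ≤ d + (∣ linked v ∣ + length L * b)
      ∣leaves∣≤ {L} cover v b parts = begin
        ∣ leaves ∣                         ≤⟨ p⊆q⇒∣p∣≤∣q∣ classify ⟩
        ∣ ∁ (N G v) ∪ (linked v ∪ ⋃P) ∣    ≤⟨ ∣p∪q∣≤∣p∣+∣q∣ (∁ (N G v)) _ ⟩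
        ∣ ∁ (N G v) ∣ + ∣ linked v ∪ ⋃P ∣  ≤⟨ +-mono-≤ (nonNeighbours≤d v) (∣p∪q∣≤∣p∣+∣q∣ (linked v) ⋃P) ⟩
        d + (∣ linked v ∣ + ∣ ⋃P ∣)        ≤⟨ +-monoʳ-≤ d (+-monoʳ-≤ ∣ linked v ∣ (∣⋃∣≤ _ b parts)) ⟩
        d + (∣ linked v ∣ + length L * b)  ∎
        where
        open ≤-Reasoning
        ⋃P : Subset n
        ⋃P = ⋃ (List.map (λ h → leaves ∩ neighbours h v) L)
        classify : leaves ⊆ ∁ (N G v) ∪ (linked v ∪ ⋃P)
        classify {a} a∈ with a ∈? N G v
        ... | no a∉ = x∈p∪q⁺ (inj₁ (x∉p⇒x∈∁p a∉))
        ... | yes a∈N with cover (color c v a)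
        ...   | inj₁ (i , eq) = x∈p∪q⁺ (inj₂ (x∈p∪q⁺ (inj₁ (∈-comprehension⁺ (linked? v)
                (i , a∈ , a∈N , sym eq)))))
        ...   | inj₂ h∈ = x∈p∪q⁺ (inj₂ (x∈p∪q⁺ (inj₂ (∈-⋃⁺ _ h∈
                (x∈p∩q⁺ (a∈ , ∈-comprehension⁺ (adjacent? _ v) (a∈N , refl)))))))

    -- L lists the colours that are not yet in use.
    grow : ∀ {k} (S : Stars k) L → (∀ h → (∃[ i ] Stars.hue S i ≡ h) ⊎ h L.∈ L) →
           ∀ j → length L ≡ j → D * e! j ≤ ∣ Stars.leaves S ∣ →
           ∃[ k′ ] k′ ≤ j + k × ∃[ S′ ] (∀ v → t ≤ ∣ Stars.linked {k′} S′ v ∣)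
    grow {k} S L cover j len large
      with all? (λ v → t ≤? ∣ Stars.linked S v ∣)
    ... | yes t≤ = k , m≤n+m k j , S , t≤
    ... | no ¬t≤ with ¬∀⟶∃¬ n _ (λ v → t ≤? ∣ Stars.linked S v ∣) ¬t≤
    -- With every colour in use, all edges from `v` to the leaves count as linked, which leaves
    -- fewer than d+t leaves.
    grow S [] cover zero refl large | no _ | v , t≰ =
      ⊥-elim (<⇒≱ (begin-strict
        ∣ leaves ∣              ≤⟨ ∣leaves∣≤ S cover v 0 [] ⟩
        d + (∣ linked v ∣ + 0)  ≡⟨ cong (d +_) (+-identityʳ ∣ linked v ∣) ⟩
        d + ∣ linked v ∣        <⟨ +-monoʳ-< d (≰⇒> t≰) ⟩
        d + t                   ≡⟨ *-identityʳ D ⟨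
        D * 1                   ∎) large)
      where
      open ≤-Reasoning
      open Stars S
    grow {k} S L cover (suc j) len large | no _ | v , t≰
      with Any.any? (λ h → D * e! j ≤? ∣ Stars.leaves S ∩ neighbours h v ∣) L
    ... | no none = ⊥-elim (<⇒≱ (begin-strict
        ∣ leaves ∣                                  ≤⟨ ∣leaves∣≤ S cover v (D * e! j) (All.map (<⇒≤ ∘ ≰⇒>) (All.¬Any⇒All¬ L none)) ⟩
        d + (∣ linked v ∣ + length L * (D * e! j))  <⟨ +-monoʳ-< d (+-monoˡ-< _ (≰⇒> t≰)) ⟩
        d + (t + length L * (D * e! j))             ≡⟨ cong (λ l → d + (t + l * (D * e! j))) len ⟩
        d + (t + suc j * (D * e! j))                ≡⟨ solve 4 (λ d t j e → d :+ (t :+ j :* ((d :+ t) :* e)) := (d :+ t) :* (j :* e :+ con 1)) refl d t (suc j) (e! j) ⟩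
        D * e! (suc j)                              ∎) large)
      where
      open ≤-Reasoning
      open Stars S
    ... | yes some with find some
    ... | h , h∈ , large′ with extract h∈
    ... | L′ , len′ , cover′ =
      map₂ (map (λ k′≤ → ≤-trans k′≤ (≤-reflexive (+-suc j k))) id)
        (grow (extend S v h few) L′ cover″ j (suc-injective (trans (sym len′) len)) large′)
      where
      open Stars S
      few : ∣ linked v ∣ < ∣ leaves ∣
      few = begin-strict
        ∣ linked v ∣    <⟨ ≰⇒> t≰ ⟩
        t               ≤⟨ m≤n+m t d ⟩
        D               ≤⟨ m≤m*n D (e! (suc j)) {{e!≢0 (suc j)}} ⟩
        D * e! (suc j)  ≤⟨ large ⟩
        ∣ leaves ∣      ∎
        where open ≤-Reasoning
      cover″ : ∀ g → (∃[ i ] (h F.∷ hue) i ≡ g) ⊎ g L.∈ L′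
      cover″ g with cover g
      ... | inj₁ (i , eq) = inj₁ (suc i , eq)
      ... | inj₂ g∈ with cover′ g∈
      ...   | inj₁ eq  = inj₁ (zero , sym eq)
      ...   | inj₂ g∈′ = inj₂ g∈′

    -- The leaves are the common coloured neighbourhood of the centres, hence all vertices when
    -- there are no centres.
    noStars : Stars 0
    noStars = record
      { centre = λ () ; injective = λ {i} → ⊥-elim (¬Fin0 i) ; hue = λ () ; leaves = ⊤ ; joined = λ () }

    dense⇒treePartition : 0 < t → D * e! r ≤ n → (∀ q → q ≤ r → n * q ^ t < suc q ^ t) →
                          ∃[ k ] k ≤ r × TreePartition c k
    dense⇒treePartition 0<t large beats =
      let k , k≤ , S , t≤ = grow noStars (allFin r) (λ h → inj₂ (∈-allFin h)) r
                              (length-tabulate id) (subst (D * e! r ≤_) (sym (∣⊤∣≡n n)) large)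
          k≤r = subst (k ≤_) (+-identityʳ r) k≤
      in k , k≤r , linked⇒treePartition S 0<t t≤ (λ q q<k → beats q (≤-trans (<⇒≤ q<k) k≤r))

-- From the minimum degree to the bound on leaves

minDegree≤n : ∀ {n} (G : Graph n) → minDegree G ≤ n
minDegree≤n {n} G = min≤⊤ n (List.tabulate (degree G))

nonNeighbours≤ : ∀ {n} (G : Graph n) v → ∣ ∁ (N G v) ∣ ≤ n ∸ minDegree G
nonNeighbours≤ {n} G v = begin
  ∣ ∁ (N G v) ∣    ≡⟨ ∣∁p∣≡n∸∣p∣ (N G v) ⟩
  n ∸ degree G v   ≤⟨ ∸-monoʳ-≤ n (min≤v⁺ n _ (inj₂ (Any.tabulate⁺ v ≤-refl))) ⟩
  n ∸ minDegree G  ∎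
  where open ≤-Reasoning

-- After scaling by `e! (suc r)`, the missing neighbours cost at most (r+1)·`e! r`·n. The final +1
-- in the recursion of `e!` leaves one n, which covers the terms in `t`.
slack : ∀ r {d t n} → e! (suc r) * d ≤ suc r * n → e! (suc r) * e! r * t ≤ n →
        (d + t) * e! r ≤ n
slack r {d} {t} {n} few small = *-cancelˡ-≤ (e! (suc r)) {{e!≢0 (suc r)}} (begin
  e! (suc r) * ((d + t) * e! r)
    ≡⟨ solve 4 (λ M d t m → M :* ((d :+ t) :* m) := m :* (M :* d) :+ M :* m :* t) refl (e! (suc r)) d t (e! r) ⟩
  e! r * (e! (suc r) * d) + e! (suc r) * e! r * t
    ≤⟨ +-mono-≤ (*-monoʳ-≤ (e! r) few) small ⟩
  e! r * (suc r * n) + n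
    ≡⟨ solve 3 (λ m s n → m :* (s :* n) :+ n := (s :* m :+ con 1) :* n) refl (e! r) (suc r) n ⟩
  e! (suc r) * n                                   ∎)
  where open ≤-Reasoning

corollary1p4 : ∀ (r : ℕ) → 2 ≤ r →
    ∃[ n₀ ] (∀ (n : ℕ) → n₀ ≤ n → (G : Graph n) →
    threshold r n <ᴿ (λ _ → fromℕ (minDegree G)) →
    tp r G ≤ r)
corollary1p4 r 2≤r = sizeBound r B , λ n n₀≤n G dense →
  let t , 0<t , small , beats = linear-size r B n {{>-nonZero (<-trans z<s 2≤r)}} {{B≢0}} n₀≤n
      large = slack r (threshold⇒ r (minDegree≤n G) dense) small
  -- `tp r G` is the least admissible bound, so it suffices that `r` is admissible.
  in proj₂ (tp-isMinimum r G) r λ c →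
       dense⇒treePartition c (nonNeighbours≤ G) 0<t large beats
  where
  -- The factor of `t` in `slack`; `linear-size` supplies a `t` with `B * t ≤ n`.
  B : ℕ
  B = e! (suc r) * e! r
  B≢0 : NonZero B
  B≢0 = m*n≢0 (e! (suc r)) (e! r) {{e!≢0 (suc r)}} {{e!≢0 r}}
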